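{- Let $k\ge1$ be an integer. We have $$G^{(k-1)(k-2)\cdots1k}_{2\text{ - }31}(x)=x^kC^2(x),$$ where $C^2(x)=(C(x))^2$. Hence $$N^{(k-1)(k-2)\cdots1k}_{2\text{ - }31}(n)=\begin{cases}C_{n-(k-1)},&\text{if }n\ge k,\\0,&\text{otherwise.}\end{cases}$$
   Context: A permutation $\pi=\pi_1\cdots\pi_n$ of $\{1,\dots,n\}$ contains the generalized pattern $2\text{ - }31$ if there are indices $i<j<n$ such that $\pi_i\pi_j\pi_{j+1}$ is order-isomorphic to $231$; otherwise it avoids it. A permutation $\pi$ begins with a pattern $p=p_1\cdots p_k$ if $n\ge k$ and $\pi_1\cdots\pi_k$ is order-isomorphic to $p$; in addition, by convention, the empty permutation is assumed to begin with the pattern $1$. The pattern $(k-1)(k-2)\cdots1k$ consists of $k-1,k-2,\dots,1$ in decreasing order followed by $k$ (for $k=1$ it is $1$, for $k=2$ it is $12$). $N^p_q(n)$ is the number of permutations of $\{1,\dots,n\}$ that avoid $q$ and begin with $p$, and $G^p_q(x)=\sum_{n\ge0}N^p_q(n)x^n$ is the ordinary generating function. $C(x)=\sum_{n\ge0}C_nx^n=\frac{1-\sqrt{1-4x}}{2x}$, with $C_n=\frac1{n+1}\binom{2n}{n}$ the Catalan numbers.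
   Formalization: For k=1 and n=0 the claim fails, since the empty permutation is taken to begin with 1, so N(0)=1; the formal statement uses 1+xC²(x) for k=1 and n≥1 in the formula for N there, and also proves both claims for all k≥1 without that convention. -}

module Defs where

open import Data.Fin using (Fin; zero; suc; toℕ; fromℕ; inject₁; _<_)
open import Data.Fin.Properties using (any?; all?; _<?_) renaming (_≟_ to _≟ᶠ_)
open import Data.List using (List; applyUpTo; cartesianProductWith; filter; length)
import Data.List as List
open import Data.Nat using (ℕ; zero; suc; _+_; _*_; _∸_; _/_; _≤_; _≤?_; _≟_)
open import Data.Nat.Combinatorics using () renaming (_C_ to _choose_)
open import Data.Nat.ListAction using (sum)
open import Data.Nat.Properties using (≤-irrelevant)
open import Data.Product using (∃; Σ; _×_; _,_; uncurry)
open import Data.Sum using (_⊎_)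
open import Data.Vec using (Vec; []; _∷_; _∷ʳ_; allFin; lookup; map; reverse; truncate)
open import Data.Vec.Relation.Unary.AllPairs using (allPairs?)
open import Data.Vec.Relation.Unary.Unique.Propositional using (Unique)
open import Function.Bundles using (_⇔_; mk⇔; Equivalence)
open import Relation.Binary.PropositionalEquality using (_≡_; subst)
open import Relation.Nullary using (Dec; yes; no; ¬_)
open import Relation.Nullary.Decidable using (map′; ¬?; _×-dec_; _⊎-dec_; _→-dec_)

-- The letters 1, …, m are represented by the elements 0, …, m - 1 of Fin m.

Word : ℕ → ℕ → Set
Word m n = Vec (Fin m) n

-- A word of length n without repeated letters over an n-letter alphabet.
IsPermutation : ∀ {n} → Word n n → Set
IsPermutation π = Unique π

OrderIso : ∀ {a b n} → Word a n → Word b n → Set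
OrderIso {n = n} u v =
  (i j : Fin n) → (lookup u i < lookup u j) ⇔ (lookup v i < lookup v j)

p231 : Word 3 3
p231 = suc zero ∷ suc (suc zero) ∷ zero ∷ []

Contains2-31 : ∀ {n} → Word n n → Set
Contains2-31 {n} π =
  ∃ λ (i : Fin n) → ∃ λ (j : Fin n) → ∃ λ (j⁺ : Fin n) →
    i < j × toℕ j⁺ ≡ suc (toℕ j) ×
    OrderIso (lookup π i ∷ lookup π j ∷ lookup π j⁺ ∷ []) p231

Avoids2-31 : ∀ {n} → Word n n → Set
Avoids2-31 π = ¬ Contains2-31 π

HasPrefix : ∀ {k n} → Word k k → Word n n → Set
HasPrefix {k} {n} p π = Σ (k ≤ n) λ k≤n → OrderIso (truncate k≤n π) p

-- HasPrefix, together with the convention that the empty permutation begins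
-- with the pattern 1 (the only pattern of length 1).
BeginsWith : ∀ {k n} → Word k k → Word n n → Set
BeginsWith {k} {n} p π = HasPrefix p π ⊎ (n ≡ 0 × k ≡ 1)

-- (k-1)(k-2)⋯1k; the value at k = 0 is a dummy.
initialPattern : (k : ℕ) → Word k k
initialPattern zero    = []
initialPattern (suc m) = map inject₁ (reverse (allFin m)) ∷ʳ fromℕ m

isPermutation? : ∀ {n} (π : Word n n) → Dec (IsPermutation π)
isPermutation? = allPairs? λ x y → ¬? (x ≟ᶠ y)

orderIso? : ∀ {a b n} (u : Word a n) (v : Word b n) → Dec (OrderIso u v)
orderIso? u v = all? λ i → all? λ j →
  map′ (uncurry mk⇔) (λ e → Equivalence.to e , Equivalence.from e)
    ((lookup u i <? lookup u j →-dec lookup v i <? lookup v j) ×-dec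
     (lookup v i <? lookup v j →-dec lookup u i <? lookup u j))

contains2-31? : ∀ {n} (π : Word n n) → Dec (Contains2-31 π)
contains2-31? π = any? λ i → any? λ j → any? λ j⁺ →
  i <? j ×-dec toℕ j⁺ ≟ suc (toℕ j) ×-dec
  orderIso? (lookup π i ∷ lookup π j ∷ lookup π j⁺ ∷ []) p231

avoids2-31? : ∀ {n} (π : Word n n) → Dec (Avoids2-31 π)
avoids2-31? π = ¬? (contains2-31? π)

hasPrefix? : ∀ {k n} (p : Word k k) (π : Word n n) → Dec (HasPrefix p π)
hasPrefix? {k} {n} p π with k ≤? n
... | no  k≰n = no λ (k≤n , _) → k≰n k≤n
... | yes k≤n = map′ (k≤n ,_)
  (λ (k≤n′ , iso) → subst (λ h → OrderIso (truncate h π) p) (≤-irrelevant k≤n′ k≤n) iso)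
  (orderIso? (truncate k≤n π) p)

beginsWith? : ∀ {k n} (p : Word k k) (π : Word n n) → Dec (BeginsWith p π)
beginsWith? {k} {n} p π = hasPrefix? p π ⊎-dec (n ≟ 0 ×-dec k ≟ 1)

-- Every word occurs exactly once.
words : (m n : ℕ) → List (Word m n)
words m zero    = List.[ [] ]
words m (suc n) = cartesianProductWith _∷_ (List.allFin m) (words m n)

N : ∀ {k} → Word k k → ℕ → ℕ
N p n = length (filter
  (λ π → isPermutation? π ×-dec avoids2-31? π ×-dec beginsWith? p π) (words n n))

-- As N, but without the convention for the empty permutation; this differs
-- from N only in that the count for the pattern 1 at n = 0 is 0 instead of 1.
N₀ : ∀ {k} → Word k k → ℕ → ℕ
N₀ p n = length (filter
  (λ π → isPermutation? π ×-dec avoids2-31? π ×-dec hasPrefix? p π) (words n n))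

-- Formal power series with natural coefficients, compared by _≗_.
Series : Set
Series = ℕ → ℕ

infixl 6 _⊕_
infixl 7 _⊛_
infixr 8 _^ˢ_

one : Series
one zero    = 1
one (suc _) = 0

X : Series
X 1 = 1
X _ = 0

_⊕_ : Series → Series → Series
(f ⊕ g) n = f n + g n

_⊛_ : Series → Series → Series
(f ⊛ g) n = sum (applyUpTo (λ i → f i * g (n ∸ i)) (suc n))

_^ˢ_ : Series → ℕ → Series
f ^ˢ zero  = one
f ^ˢ suc n = f ⊛ f ^ˢ n

G : ∀ {k} → Word k k → Series
G p n = N p n

G₀ : ∀ {k} → Word k k → Series
G₀ p n = N₀ p n

-- The division is exact.
catalan : ℕ → ℕ
catalan n = ((2 * n) choose n) / suc n

C : Series
C n = catalan n

{-# OPTIONS --safe #-}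
module Submission where

-- If π avoids 2-31, then after any entry x, everything below x precedes everything above x:
-- an entry below x after one above x would force a descent across x.  Splitting π at its first
-- entry therefore identifies the avoiding permutations with binary trees, whose number c satisfies
-- c(n+1) = (c ⊛ c)(n).  If moreover π₁ > ⋯ > πₖ₋₁ and πₖ > π₁, then everything from πₖ on exceeds
-- π₁, so π = (k-1)⋯1 τ with τ an arbitrary nonempty avoiding permutation of {k, …, n}.
--
-- Closed form of c: for Q = Σ i cᵢ cₙ₋ᵢ symmetry gives 2 Q = n c(n+1), and this turns the
-- convolution recurrence into (n+2) c(n+1) = (4n+2) c(n), the recurrence of binom(2n, n) / (n+1).

open import Defs
open import Data.Bool using (true; false; T; if_then_else_)
open import Data.Fin as Fin using (Fin; zero; suc; toℕ; fromℕ; fromℕ<; inject₁)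
open import Data.Fin.Properties using (toℕ-injective; toℕ<n; toℕ-inject₁; toℕ-fromℕ; toℕ-fromℕ<)
open import Data.Fin.Relation.Unary.Top using (view; ‵fromℕ; ‵inject₁)
open import Data.List as List using (List; []; _∷_; _++_; [_]; length; map; concat; applyUpTo; cartesianProductWith; downFrom; filter; upTo)
open import Data.List.Properties
  using (∷-injectiveˡ; ∷-injectiveʳ; length-++; length-map; length-applyUpTo; length-downFrom; ++-assoc; filter-none; filter-≐; reverse-upTo; reverse-map)
open import Data.List.Membership.Propositional using (_∈_)
open import Data.List.Membership.Propositional.Properties
open import Data.List.Relation.Binary.Disjoint.Propositional using (Disjoint)
open import Data.List.Relation.Binary.Subset.Propositional using (_⊆_)
open import Data.List.Relation.Unary.All as All using (All; []; _∷_)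
open import Data.List.Relation.Unary.All.Properties
  using (All¬⇒¬Any; ++⁺; ++⁻ˡ; ++⁻ʳ) renaming (applyUpTo⁺₂ to All-applyUpTo⁺₂; applyDownFrom⁺₁ to All-applyDownFrom⁺₁)
open import Data.List.Relation.Unary.AllPairs as AllPairs using (AllPairs; []; _∷_)
import Data.List.Relation.Unary.AllPairs.Properties as AllPairsₚ
open import Data.List.Relation.Unary.Any using (here; there)
open import Data.List.Relation.Unary.Linked as Linked using (Linked; []; [-]; _∷_)
open import Data.List.Relation.Unary.Unique.Propositional using (Unique)
import Data.List.Relation.Unary.Unique.Propositional.Properties as Unique
open import Data.Nat
open import Data.Nat.Combinatorics using (nCk≡n!/k![n-k]!; k![n∸k]!∣n!) renaming (_C_ to _choose_)
open import Data.Nat.DivMod using (m/n*n≡m; m*n/n≡m)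
open import Data.Nat.ListAction using (sum)
open import Data.Nat.Properties
open import Data.Nat.Tactic.RingSolver using (solve-∀)
open import Data.Product using (∃-syntax; _×_; _,_; proj₁; proj₂)
open import Data.Sum using (inj₁; inj₂)
open import Data.Unit using (tt)
open import Data.Vec as Vec using (Vec; []; _∷_; _∷ʳ_; lookup; toList; truncate; initLast; allFin)
open import Data.Vec.Properties using (toList-reverse; ∷-injective)
import Data.Vec.Relation.Unary.All as VecAll
import Data.Vec.Relation.Unary.AllPairs as VecAllPairs
open import Function using (_∘_; id)
open import Function.Bundles using (_⇔_; mk⇔; Equivalence)
open import Relation.Binary.Definitions using (tri<; tri≈; tri>)
open import Relation.Binary.PropositionalEquality hiding ([_])
open import Relation.Nullary using (¬_; contradiction)
open import Relation.Nullary.Decidable using (_×-dec_)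
open import Relation.Unary using (Decidable)
open Equivalence using (to; from)
open ≡-Reasoning

-- Power series

⊛-cong : ∀ (f f′ g : Series) n → (∀ i → i ≤ n → f i ≡ f′ i) → (f ⊛ g) n ≡ (f′ ⊛ g) n
⊛-cong f f′ g zero    eq = cong (λ a → a * g 0 + 0) (eq 0 z≤n)
⊛-cong f f′ g (suc n) eq =
  cong₂ (λ a b → a * g (suc n) + b) (eq 0 z≤n) (⊛-cong (f ∘ suc) (f′ ∘ suc) g n (λ i i≤n → eq (suc i) (s≤s i≤n)))

⊛-congʳ : ∀ (f : Series) {g g′ : Series} → g ≗ g′ → f ⊛ g ≗ f ⊛ g′
⊛-congʳ f eq zero    = cong (λ a → f 0 * a + 0) (eq 0)
⊛-congʳ f eq (suc n) = cong₂ (λ a b → f 0 * a + b) (eq (suc n)) (⊛-congʳ (f ∘ suc) eq n)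

-- `⊛` computes by its first summand. Exchanging the factors reverses the sum, so commutativity also
-- needs the last summand split off.
⊛-last : ∀ (f g : Series) n → (f ⊛ g) (suc n) ≡ (f ⊛ (g ∘ suc)) n + f (suc n) * g 0
⊛-last f g zero    = lemma (f 0 * g 1) (f 1 * g 0)
  where
  lemma : ∀ a b → a + (b + 0) ≡ a + 0 + b
  lemma = solve-∀
⊛-last f g (suc n) = begin
  a + ((f ∘ suc) ⊛ g) (suc n)                ≡⟨ cong (a +_) (⊛-last (f ∘ suc) g n) ⟩
  a + (((f ∘ suc) ⊛ (g ∘ suc)) n + b)        ≡⟨ +-assoc a _ b ⟨
  a + ((f ∘ suc) ⊛ (g ∘ suc)) n + b          ∎
  where a = f 0 * g (suc (suc n)) ; b = f (suc (suc n)) * g 0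

⊛-comm : ∀ (f g : Series) → f ⊛ g ≗ g ⊛ f
⊛-comm f g zero    = cong (_+ 0) (*-comm (f 0) (g 0))
⊛-comm f g (suc n) = begin
  f 0 * g (suc n) + ((f ∘ suc) ⊛ g) n  ≡⟨ cong₂ _+_ (*-comm (f 0) _) (⊛-comm (f ∘ suc) g n) ⟩
  g (suc n) * f 0 + (g ⊛ (f ∘ suc)) n  ≡⟨ +-comm (g (suc n) * f 0) _ ⟩
  (g ⊛ (f ∘ suc)) n + g (suc n) * f 0  ≡⟨ ⊛-last g f n ⟨
  (g ⊛ f) (suc n)                      ∎

⊛-distribʳ-⊕ : ∀ (h f g : Series) → (f ⊕ g) ⊛ h ≗ (f ⊛ h) ⊕ (g ⊛ h)
⊛-distribʳ-⊕ h f g zero    = lemma (f 0) (g 0) (h 0)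
  where
  lemma : ∀ a b c → (a + b) * c + 0 ≡ a * c + 0 + (b * c + 0)
  lemma = solve-∀
⊛-distribʳ-⊕ h f g (suc n) = begin
  (f 0 + g 0) * h (suc n) + (((f ∘ suc) ⊕ (g ∘ suc)) ⊛ h) n
    ≡⟨ cong ((f 0 + g 0) * h (suc n) +_) (⊛-distribʳ-⊕ h (f ∘ suc) (g ∘ suc) n) ⟩
  (f 0 + g 0) * h (suc n) + (((f ∘ suc) ⊛ h) n + ((g ∘ suc) ⊛ h) n)
    ≡⟨ lemma (f 0) (g 0) (h (suc n)) _ _ ⟩
  f 0 * h (suc n) + ((f ∘ suc) ⊛ h) n + (g 0 * h (suc n) + ((g ∘ suc) ⊛ h) n) ∎
  where
  lemma : ∀ a b c d e → (a + b) * c + (d + e) ≡ a * c + d + (b * c + e)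
  lemma = solve-∀

⊛-scaleˡ : ∀ a (f g : Series) n → ((λ i → a * f i) ⊛ g) n ≡ a * (f ⊛ g) n
⊛-scaleˡ a f g zero    = lemma a (f 0) (g 0)
  where
  lemma : ∀ a b c → a * b * c + 0 ≡ a * (b * c + 0)
  lemma = solve-∀
⊛-scaleˡ a f g (suc n) =
  trans (cong (a * f 0 * g (suc n) +_) (⊛-scaleˡ a (f ∘ suc) g n)) (lemma a (f 0) (g (suc n)) _)
  where
  lemma : ∀ a b c d → a * b * c + a * d ≡ a * (b * c + d)
  lemma = solve-∀

-- x · d/dx
D : Series → Series
D f n = n * f n

-- The weights `i` and `n ∸ i` of the two factors of a summand add up to `n`.
⊛-leibniz : ∀ (f g : Series) n → (D f ⊛ g) n + (f ⊛ D g) n ≡ n * (f ⊛ g) n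
⊛-leibniz f g zero    = lemma (f 0)
  where
  lemma : ∀ a → a * 0 + 0 ≡ 0
  lemma = solve-∀
⊛-leibniz f g (suc n) = begin
  -- `D f` has constant term 0, and its shift unfolds to `(f ∘ suc) ⊕ D (f ∘ suc)`, because
  -- `suc n * a` is `a + n * a`.
  (((f ∘ suc) ⊕ D (f ∘ suc)) ⊛ g) n + (f 0 * (suc n * b) + ((f ∘ suc) ⊛ D g) n)
    ≡⟨ cong (_+ (f 0 * (suc n * b) + ((f ∘ suc) ⊛ D g) n)) (⊛-distribʳ-⊕ g (f ∘ suc) (D (f ∘ suc)) n) ⟩
  s + (D (f ∘ suc) ⊛ g) n + (f 0 * (suc n * b) + ((f ∘ suc) ⊛ D g) n)
    ≡⟨ regroup s _ _ _ ⟩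
  s + ((D (f ∘ suc) ⊛ g) n + ((f ∘ suc) ⊛ D g) n) + f 0 * (suc n * b)
    ≡⟨ cong (λ a → s + a + f 0 * (suc n * b)) (⊛-leibniz (f ∘ suc) g n) ⟩
  s + n * s + f 0 * (suc n * b)
    ≡⟨ factor s n (f 0) b ⟩
  suc n * (f 0 * b + s) ∎
  where
  b = g (suc n)
  s = ((f ∘ suc) ⊛ g) n
  regroup : ∀ a b c d → a + b + (c + d) ≡ a + (b + d) + c
  regroup = solve-∀
  factor : ∀ s n a b → s + n * s + a * (suc n * b) ≡ suc n * (a * b + s)
  factor = solve-∀

⊛-identityˡ : ∀ (f : Series) → one ⊛ f ≗ f
⊛-identityˡ f n = trans (⊛-comm one f n) (identityʳ f n)
  where
  identityʳ : ∀ f → f ⊛ one ≗ f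
  identityʳ f zero    = trans (+-identityʳ _) (*-identityʳ (f 0))
  identityʳ f (suc n) = cong₂ _+_ (*-zeroʳ (f 0)) (identityʳ (f ∘ suc) n)

X⊛-suc : ∀ (f : Series) n → (X ⊛ f) (suc n) ≡ f n
X⊛-suc f n = trans (⊛-cong (X ∘ suc) one f n (λ { zero _ → refl ; (suc _) _ → refl })) (⊛-identityˡ f n)

X^suc⊛-suc : ∀ k (f : Series) n → (X ^ˢ suc k ⊛ f) (suc n) ≡ (X ^ˢ k ⊛ f) n
X^suc⊛-suc k f n = ⊛-cong ((X ^ˢ suc k) ∘ suc) (X ^ˢ k) f n (λ i _ → X⊛-suc (X ^ˢ k) i)

X^⊛-long : ∀ k (f : Series) {n} → k ≤ n → (X ^ˢ k ⊛ f) n ≡ f (n ∸ k)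
X^⊛-long zero    f {n}     _         = ⊛-identityˡ f n
X^⊛-long (suc k) f {suc n} (s≤s k≤n) = trans (X^suc⊛-suc k f n) (X^⊛-long k f k≤n)

X^⊛-short : ∀ k (f : Series) {n} → n < k → (X ^ˢ k ⊛ f) n ≡ 0
X^⊛-short (suc k) f {zero}  _         = refl
X^⊛-short (suc k) f {suc n} (s≤s n<k) = trans (X^suc⊛-suc k f n) (X^⊛-short k f n<k)

-- From Segner's recurrence to the closed form of the Catalan numbers

module Segner (c : Series) (c-zero : c 0 ≡ 1) (c-suc : ∀ n → c (suc n) ≡ (c ⊛ c) n) where

  -- The reflection of `i` to `n ∸ i` moves the weight to the other factor without changing the sum;
  -- the two weighted sums then add up by the Leibniz rule.
  2*D-self : ∀ n → 2 * (D c ⊛ c) n ≡ n * (c ⊛ c) n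
  2*D-self n = begin
    2 * (D c ⊛ c) n              ≡⟨ cong ((D c ⊛ c) n +_) (+-identityʳ _) ⟩
    (D c ⊛ c) n + (D c ⊛ c) n    ≡⟨ cong ((D c ⊛ c) n +_) (⊛-comm (D c) c n) ⟩
    (D c ⊛ c) n + (c ⊛ D c) n    ≡⟨ ⊛-leibniz c c n ⟩
    n * (c ⊛ c) n                ∎

  Ratio : ℕ → Set
  Ratio n = suc (suc n) * c (suc n) ≡ (4 * n + 2) * c n

  -- Convolving the ratio identities for all `i ≤ n` with `c` relates the weighted sums at `n + 1`
  -- to those at `n`; `2*D-self` then removes the weights.
  ratio-step : ∀ n → (∀ i → i ≤ n → Ratio i) → Ratio (suc n)
  ratio-step n ratio = begin
    (3 + n) * c (2 + n)                        ≡⟨ cong ((3 + n) *_) (c-suc (suc n)) ⟩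
    (3 + n) * S₊                               ≡⟨ e₁ n S₊ ⟩
    suc n * S₊ + 2 * S₊                        ≡⟨ cong (_+ 2 * S₊) (2*D-self (suc n)) ⟨
    -- The first summand of `S₊` is split off, so that the remainder `R` can join `Q₊` in `key`.
    2 * Q₊ + 2 * S₊                            ≡⟨ cong (λ a → 2 * Q₊ + 2 * (a * c (suc n) + R)) c-zero ⟩
    2 * Q₊ + 2 * (1 * c (suc n) + R)           ≡⟨ e₂ Q₊ R (c (suc n)) ⟩
    2 * (R + Q₊) + 2 * c (suc n)               ≡⟨ cong (λ a → 2 * a + 2 * c (suc n)) key ⟩
    2 * (4 * Q + 2 * S) + 2 * c (suc n)        ≡⟨ e₃ Q S (c (suc n)) ⟩
    4 * (2 * Q) + 4 * S + 2 * c (suc n)        ≡⟨ cong (λ a → 4 * a + 4 * S + 2 * c (suc n)) (2*D-self n) ⟩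
    4 * (n * S) + 4 * S + 2 * c (suc n)        ≡⟨ cong (λ a → 4 * (n * a) + 4 * a + 2 * c (suc n)) (c-suc n) ⟨
    4 * (n * c (suc n)) + 4 * c (suc n) + 2 * c (suc n) ≡⟨ e₄ n (c (suc n)) ⟩
    (4 * suc n + 2) * c (suc n)                ∎
    where
    S = (c ⊛ c) n
    Q = (D c ⊛ c) n
    S₊ = (c ⊛ c) (suc n)
    Q₊ = (D c ⊛ c) (suc n)
    R = ((c ∘ suc) ⊛ c) n
    e₁ : ∀ n s → (3 + n) * s ≡ suc n * s + 2 * s
    e₁ = solve-∀
    e₂ : ∀ t r a → 2 * t + 2 * (1 * a + r) ≡ 2 * (r + t) + 2 * a
    e₂ = solve-∀
    e₃ : ∀ t s a → 2 * (4 * t + 2 * s) + 2 * a ≡ 4 * (2 * t) + 4 * s + 2 * a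
    e₃ = solve-∀
    e₄ : ∀ n a → 4 * (n * a) + 4 * a + 2 * a ≡ (4 * suc n + 2) * a
    e₄ = solve-∀
    e₅ : ∀ i a → (4 * i + 2) * a ≡ 4 * (i * a) + 2 * a
    e₅ = solve-∀
    key : R + Q₊ ≡ 4 * Q + 2 * S
    key = begin
      -- Here `Q₊` is a convolution with `D c ∘ suc`, as `D c` vanishes at 0. The coefficients
      -- `c (i + 1) + (i + 1) * c (i + 1)` of the sum are the left side of `Ratio i`.
      R + Q₊
        ≡⟨ ⊛-distribʳ-⊕ c (c ∘ suc) (D c ∘ suc) n ⟨
      (((c ∘ suc) ⊕ (D c ∘ suc)) ⊛ c) n
        ≡⟨ ⊛-cong _ ((λ i → 4 * D c i) ⊕ (λ i → 2 * c i)) c n (λ i i≤n → trans (ratio i i≤n) (e₅ i (c i))) ⟩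
      (((λ i → 4 * D c i) ⊕ (λ i → 2 * c i)) ⊛ c) n
        ≡⟨ ⊛-distribʳ-⊕ c (λ i → 4 * D c i) (λ i → 2 * c i) n ⟩
      ((λ i → 4 * D c i) ⊛ c) n + ((λ i → 2 * c i) ⊛ c) n
        ≡⟨ cong₂ _+_ (⊛-scaleˡ 4 (D c) c n) (⊛-scaleˡ 2 c c n) ⟩
      4 * Q + 2 * S ∎

  -- Strong induction on `i`, made structural by the bound `n`.
  ratio≤ : ∀ n i → i ≤ n → Ratio i
  ratio≤ n       zero    _         = cong (2 *_) (begin
    c 1          ≡⟨ c-suc 0 ⟩
    c 0 * c 0 + 0 ≡⟨ cong (λ a → a * c 0 + 0) c-zero ⟩
    c 0 + 0 + 0  ≡⟨ +-identityʳ _ ⟩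
    c 0 + 0      ≡⟨ +-identityʳ _ ⟩
    c 0          ∎)
  ratio≤ (suc n) (suc i) (s≤s i≤n) = ratio-step i (λ j j≤i → ratio≤ n j (≤-trans j≤i i≤n))

  ratio : ∀ n → Ratio n
  ratio n = ratio≤ n n ≤-refl

-- Central binomial coefficients

central : ℕ → ℕ
central n = (2 * n) choose n

central-! : ∀ n → central n * (n ! * n !) ≡ (2 * n) !
central-! n = begin
  central n * (n ! * n !)            ≡⟨ cong (λ m → central n * (n ! * m !)) 2n∸n ⟨
  central n * (n ! * (2 * n ∸ n) !)  ≡⟨ cong (_* (n ! * (2 * n ∸ n) !)) (nCk≡n!/k![n-k]! n≤2n) ⟩
  _                                  ≡⟨ m/n*n≡m {{n !* (2 * n ∸ n) !≢0}} (k![n∸k]!∣n! n≤2n) ⟩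
  (2 * n) !                          ∎
  where
  n≤2n : n ≤ 2 * n
  n≤2n = m≤m+n n _
  2n∸n : 2 * n ∸ n ≡ n
  2n∸n = trans (m+n∸m≡n n (n + 0)) (+-identityʳ n)

-- Multiplying by `suc n * (n ! * n !)` turns both sides into `(2n + 2)!`, so everything happens
-- without division.
central-ratio : ∀ n → suc n * central (suc n) ≡ (4 * n + 2) * central n
central-ratio n = *-cancelʳ-≡ _ _ (suc n * (n ! * n !)) (begin
  suc n * central (suc n) * (suc n * (n ! * n !))      ≡⟨ e₁ n (central (suc n)) (n !) ⟩
  central (suc n) * (suc n ! * suc n !)                ≡⟨ central-! (suc n) ⟩
  (2 * suc n) !                                        ≡⟨ cong _! (*-suc 2 n) ⟩
  (2 + 2 * n) * ((1 + 2 * n) * (2 * n) !)              ≡⟨ cong (λ a → (2 + 2 * n) * ((1 + 2 * n) * a)) (central-! n) ⟨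
  (2 + 2 * n) * ((1 + 2 * n) * (central n * (n ! * n !))) ≡⟨ e₂ n (central n) (n ! * n !) ⟩
  (4 * n + 2) * central n * (suc n * (n ! * n !))      ∎)
  where
  instance
    _ : NonZero (suc n * (n ! * n !))
    _ = m*n≢0 (suc n) (n ! * n !) {{_}} {{n !* n !≢0}}
  e₁ : ∀ n b a → suc n * b * (suc n * (a * a)) ≡ b * (suc n * a * (suc n * a))
  e₁ = solve-∀
  e₂ : ∀ n b a → (2 + 2 * n) * ((1 + 2 * n) * (b * a)) ≡ (4 * n + 2) * b * (suc n * a)
  e₂ = solve-∀

module _ (c : Series) (c-zero : c 0 ≡ 1) (c-suc : ∀ n → c (suc n) ≡ (c ⊛ c) n) where

  -- Both sides start at 1 and grow by the same ratio. An extra factor `suc n` is carried and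
  -- cancelled, since the ratios are known only with denominators cleared.
  c-central : ∀ n → c n * suc n ≡ central n
  c-central zero    = trans (*-identityʳ _) c-zero
  c-central (suc n) = *-cancelʳ-≡ _ _ (suc n) (begin
    c (suc n) * suc (suc n) * suc n  ≡⟨ cong (_* suc n) (*-comm (c (suc n)) _) ⟩
    suc (suc n) * c (suc n) * suc n  ≡⟨ cong (_* suc n) (Segner.ratio c c-zero c-suc n) ⟩
    (4 * n + 2) * c n * suc n        ≡⟨ *-assoc (4 * n + 2) (c n) (suc n) ⟩
    (4 * n + 2) * (c n * suc n)      ≡⟨ cong ((4 * n + 2) *_) (c-central n) ⟩
    (4 * n + 2) * central n          ≡⟨ central-ratio n ⟨
    suc n * central (suc n)          ≡⟨ *-comm (suc n) _ ⟩
    central (suc n) * suc n          ∎)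

  segner⇒catalan : c ≗ catalan
  segner⇒catalan n = begin
    c n                      ≡⟨ m*n/n≡m (c n) (suc n) ⟨
    (c n * suc n) / suc n    ≡⟨ cong (_/ suc n) (c-central n) ⟩
    catalan n                ∎

-- Lists of numbers avoiding 2-31

++-injective : ∀ {A : Set} (as : List A) {bs cs ds} → length as ≡ length cs →
  as ++ bs ≡ cs ++ ds → as ≡ cs × bs ≡ ds
++-injective []       {cs = []}     _  eq = refl , eq
++-injective (a ∷ as) {cs = c ∷ cs} le eq with refl ← ∷-injectiveˡ eq
  with as≡cs , bs≡ds ← ++-injective as {cs = cs} (suc-injective le) (∷-injectiveʳ eq) =
  cong (a ∷_) as≡cs , bs≡ds

AllPairs-++⁻ˡ : ∀ {A : Set} {R : A → A → Set} as {bs} → AllPairs R (as ++ bs) → AllPairs R as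
AllPairs-++⁻ˡ []       _        = []
AllPairs-++⁻ˡ (a ∷ as) (r ∷ rs) = ++⁻ˡ as r ∷ AllPairs-++⁻ˡ as rs

AllPairs-++⁻ʳ : ∀ {A : Set} {R : A → A → Set} as {bs} → AllPairs R (as ++ bs) → AllPairs R bs
AllPairs-++⁻ʳ []       rs       = rs
AllPairs-++⁻ʳ (a ∷ as) (_ ∷ rs) = AllPairs-++⁻ʳ as rs

Unique-++-< : ∀ {xs ys} → Unique xs → Unique ys → All (λ x → All (x <_) ys) xs → Unique (xs ++ ys)
Unique-++-< ux uy xs<ys = AllPairsₚ.++⁺ ux uy (All.map (All.map <⇒≢) xs<ys)

-- The pigeonhole principle: delete the head of `xs` from `ys`; the other entries of `xs` differ
-- from it and survive the deletion.
unique-⊆⇒length≤ : ∀ {A : Set} {xs ys : List A} → Unique xs → xs ⊆ ys → length xs ≤ length ys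
unique-⊆⇒length≤ {xs = []}     _        _   = z≤n
unique-⊆⇒length≤ {xs = x ∷ xs} (x∉ ∷ u) sub with as , bs , refl ← ∈-∃++ (sub (here refl)) =
  ≤-trans (s≤s (unique-⊆⇒length≤ u sub′)) (≤-reflexive (begin
    suc (length (as ++ bs))      ≡⟨ cong suc (length-++ as) ⟩
    suc (length as + length bs)  ≡⟨ +-suc (length as) _ ⟨
    length as + suc (length bs)  ≡⟨ length-++ as ⟨
    length (as ++ x ∷ bs)        ∎))
  where
  drop-middle : ∀ cs {y} → y ≢ x → y ∈ cs ++ x ∷ bs → y ∈ cs ++ bs
  drop-middle []       y≢x (here y≡x) = contradiction y≡x y≢x
  drop-middle []       y≢x (there y∈) = y∈
  drop-middle (c ∷ cs) y≢x (here y≡c) = here y≡c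
  drop-middle (c ∷ cs) y≢x (there y∈) = there (drop-middle cs y≢x y∈)
  sub′ : xs ⊆ as ++ bs
  sub′ y∈xs = drop-middle as (λ { refl → All¬⇒¬Any x∉ y∈xs }) (sub (there y∈xs))

unique-≋⇒length≡ : ∀ {A : Set} {xs ys : List A} → Unique xs → Unique ys →
  xs ⊆ ys → ys ⊆ xs → length xs ≡ length ys
unique-≋⇒length≡ ux uy xs⊆ys ys⊆xs = ≤-antisym (unique-⊆⇒length≤ ux xs⊆ys) (unique-⊆⇒length≤ uy ys⊆xs)

InRange : ℕ → ℕ → ℕ → Set
InRange lo n x = lo ≤ x × x < lo + n

interval-length≤ : ∀ {lo n xs} → Unique xs → All (InRange lo n) xs → length xs ≤ n
interval-length≤ {lo} {n} {xs} u inr =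
  subst (length xs ≤_) (length-applyUpTo (lo +_) n) (unique-⊆⇒length≤ u sub)
  where
  sub : xs ⊆ applyUpTo (lo +_) n
  sub x∈ with lo≤x , x<hi ← All.lookup inr x∈ with o , refl ← m≤n⇒∃[o]m+o≡n lo≤x =
    ∈-applyUpTo⁺ (lo +_) (+-cancelˡ-< lo o n x<hi)

-- A permutation of the interval of `length xs` numbers starting at `lo`; by pigeonhole,
-- distinctness and range suffice. The offset lets blocks of a permutation keep their values.
PermFrom : ℕ → List ℕ → Set
PermFrom lo xs = Unique xs × All (InRange lo (length xs)) xs

-- No adjacent pair of the list plays the 31 of a 2-31 whose 2 is x.
NoDrop : ℕ → List ℕ → Set
NoDrop x = Linked (λ y z → ¬ (z < x × x < y))

data Avoiding : List ℕ → Set where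
  []  : Avoiding []
  _∷_ : ∀ {x xs} → NoDrop x xs → Avoiding xs → Avoiding (x ∷ xs)

noDrop-above : ∀ {x xs} → All (x ≤_) xs → NoDrop x xs
noDrop-above []                  = []
noDrop-above (_ ∷ [])            = [-]
noDrop-above (_ ∷ x≤z ∷ x≤zs) = (λ (z<x , _) → <⇒≱ z<x x≤z) ∷ noDrop-above (x≤z ∷ x≤zs)

-- The step across the seam ends above `x`, hence is no drop below it.
noDrop-++ : ∀ {x xs ys} → NoDrop x xs → All (x <_) ys → NoDrop x (xs ++ ys)
noDrop-++ []        x<ys = noDrop-above (All.map <⇒≤ x<ys)
noDrop-++ [-]       []   = [-]
noDrop-++ [-] (x<y ∷ x<ys) = (λ (y<x , _) → <-asym x<y y<x) ∷ noDrop-above (All.map <⇒≤ (x<y ∷ x<ys))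
noDrop-++ (r ∷ rs)  x<ys = r ∷ noDrop-++ rs x<ys

noDrop-below : ∀ {x xs} → All (_< x) xs → NoDrop x xs
noDrop-below []                  = []
noDrop-below (_ ∷ [])            = [-]
noDrop-below (y<x ∷ z<x ∷ zs<x) = (λ (_ , x<y) → <-asym y<x x<y) ∷ noDrop-below (z<x ∷ zs<x)

avoiding-++ : ∀ {xs ys} → Avoiding xs → Avoiding ys → All (λ x → All (x <_) ys) xs → Avoiding (xs ++ ys)
avoiding-++ []       ay []             = ay
avoiding-++ (r ∷ ax) ay (x<ys ∷ xs<ys) = noDrop-++ r x<ys ∷ avoiding-++ ax ay xs<ys

avoiding-++⁻ʳ : ∀ xs {ys} → Avoiding (xs ++ ys) → Avoiding ys
avoiding-++⁻ʳ []       a       = a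
avoiding-++⁻ʳ (x ∷ xs) (_ ∷ a) = avoiding-++⁻ʳ xs a

noDrop-++⁻ˡ : ∀ {x} xs {ys} → NoDrop x (xs ++ ys) → NoDrop x xs
noDrop-++⁻ˡ []           _        = []
noDrop-++⁻ˡ (y ∷ [])     _        = [-]
noDrop-++⁻ˡ (y ∷ z ∷ xs) (r ∷ rs) = r ∷ noDrop-++⁻ˡ (z ∷ xs) rs

noDrop-++⁻ʳ : ∀ {x} xs {ys} → NoDrop x (xs ++ ys) → NoDrop x ys
noDrop-++⁻ʳ []       rs = rs
noDrop-++⁻ʳ (y ∷ xs) rs = noDrop-++⁻ʳ xs (Linked.tail rs)

avoiding-++⁻ˡ : ∀ xs {ys} → Avoiding (xs ++ ys) → Avoiding xs
avoiding-++⁻ˡ []       _       = []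
avoiding-++⁻ˡ (x ∷ xs) (r ∷ a) = noDrop-++⁻ˡ xs r ∷ avoiding-++⁻ˡ xs a

-- An entry below x would be reached from above x in a single descent.
stays-above : ∀ {x y ys} → NoDrop x (y ∷ ys) → All (x ≢_) (y ∷ ys) → x < y → All (x <_) (y ∷ ys)
stays-above [-]                _                x<y = x<y ∷ []
stays-above {x} (r ∷ rs) (_ ∷ x≢z ∷ x≢zs) x<y =
  x<y ∷ stays-above rs (x≢z ∷ x≢zs) (≤∧≢⇒< (≮⇒≥ (λ z<x → r (z<x , x<y))) x≢z)

-- The cut is made at the first entry above `x`; from there on `stays-above` applies.
split-at : ∀ {x} ys → NoDrop x ys → All (x ≢_) ys →
  ∃[ σ ] ∃[ τ ] ys ≡ σ ++ τ × All (_< x) σ × All (x <_) τ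
split-at     []       _ _           = [] , [] , refl , [] , []
split-at {x} (y ∷ ys) r (x≢y ∷ x≢ys) with <-cmp x y
... | tri< x<y _ _ = [] , y ∷ ys , refl , [] , stays-above r (x≢y ∷ x≢ys) x<y
... | tri≈ _ x≡y _ = contradiction x≡y x≢y
... | tri> _ _ y<x with σ , τ , refl , σ< , <τ ← split-at ys (Linked.tail r) x≢ys =
  y ∷ σ , τ , refl , y<x ∷ σ< , <τ

-- Binary trees and avoiding permutations

data Tree : Set where
  leaf : Tree
  node : Tree → Tree → Tree

size : Tree → ℕ
size leaf       = 0
size (node l r) = suc (size l + size r)

-- The preorder reading of the binary search tree of this shape with labels `lo`, `lo + 1`, and so
-- on.
word : ℕ → Tree → List ℕ
word lo leaf       = []
word lo (node l r) = lo + size l ∷ word lo l ++ word (suc (lo + size l)) r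

length-word : ∀ lo t → length (word lo t) ≡ size t
length-word lo leaf       = refl
length-word lo (node l r) = cong suc
  (trans (length-++ (word lo l)) (cong₂ _+_ (length-word lo l) (length-word _ r)))

-- The first letter reveals the size of the left subtree, and with it the place where the rest is to
-- be cut.
word-injective : ∀ lo {t u} → word lo t ≡ word lo u → t ≡ u
word-injective lo {leaf}     {leaf}       _  = refl
word-injective lo {node l r} {node l′ r′} eq
  with |l|≡|l′| ← +-cancelˡ-≡ lo (size l) (size l′) (∷-injectiveˡ eq)
  with l≡ , r≡ ← ++-injective (word lo l)
         (trans (length-word lo l) (trans |l|≡|l′| (sym (length-word lo l′)))) (∷-injectiveʳ eq)
  with refl ← word-injective lo {l} {l′} l≡ =
  cong (node l) (word-injective _ r≡)

word-range : ∀ lo t → All (InRange lo (size t)) (word lo t)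
word-range lo leaf       = []
word-range lo (node l r) =
  (m≤m+n lo _ , +-monoʳ-< lo (s≤s (m≤m+n (size l) _))) ∷
  ++⁺ (All.map (λ (lo≤x , x<) → lo≤x , <-≤-trans x< (+-monoʳ-≤ lo (m≤n⇒m≤1+n (m≤m+n (size l) _)))) (word-range lo l))
      (All.map (λ {x} (lo≤x , x<) → ≤-trans (m≤m+n lo _) (<⇒≤ lo≤x) ,
                  subst (x <_) (trans (cong suc (+-assoc lo (size l) (size r))) (sym (+-suc lo _))) x<)
               (word-range _ r))

word-left< : ∀ lo l → All (_< lo + size l) (word lo l)
word-left< lo l = All.map proj₂ (word-range lo l)

word-≥ : ∀ lo t → All (lo ≤_) (word lo t)
word-≥ lo t = All.map proj₁ (word-range lo t)

word-left<right : ∀ lo l r → All (λ x → All (x <_) (word (suc (lo + size l)) r)) (word lo l)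
word-left<right lo l r = All.map (λ x<a → All.map (<-trans x<a) (word-≥ _ r)) (word-left< lo l)

word-unique : ∀ lo t → Unique (word lo t)
word-unique lo leaf       = []
word-unique lo (node l r) =
  ++⁺ (All.map >⇒≢ (word-left< lo l)) (All.map <⇒≢ (word-≥ _ r)) ∷
  Unique-++-< (word-unique lo l) (word-unique _ r) (word-left<right lo l r)

word-avoiding : ∀ lo t → Avoiding (word lo t)
word-avoiding lo leaf       = []
word-avoiding lo (node l r) =
  noDrop-++ (noDrop-below (word-left< lo l)) (word-≥ _ r) ∷
  avoiding-++ (word-avoiding lo l) (word-avoiding _ r) (word-left<right lo l r)

-- Used to turn two pigeonhole bounds with a known total into exact block lengths.
both-tight : ∀ {a b i j} → a ≤ i → b ≤ j → a + b ≡ i + j → a ≡ i × b ≡ j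
both-tight {a} {b} {i} {j} a≤i b≤j eq with m≤n⇒m<n∨m≡n a≤i
... | inj₁ a<i = contradiction eq (<⇒≢ (+-mono-<-≤ a<i b≤j))
... | inj₂ refl = refl , +-cancelˡ-≡ a b j eq

-- h bounds the length; it only makes the recursion structural.
tree-of : ∀ h lo xs → length xs ≤ h → PermFrom lo xs → Avoiding xs → ∃[ t ] word lo t ≡ xs
tree-of h       lo []       _         _                                  _        = leaf , refl
tree-of (suc h) lo (x ∷ xs) (s≤s len) (x≢ ∷ u , (lo≤x , x<) ∷ inr) (nd ∷ av)
  -- The range holds `i` values below `x = lo + i` and, with `j` from the last match, `j` values
  -- above it.
  with i , refl ← m≤n⇒∃[o]m+o≡n lo≤x
  with σ , τ , refl , σ<x , x<τ ← split-at xs nd x≢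
  with j , i+j≡ ← m≤n⇒∃[o]m+o≡n (s≤s⁻¹ (+-cancelˡ-< lo i _ x<)) = finish
  where
  uσ = AllPairs-++⁻ˡ σ u
  uτ = AllPairs-++⁻ʳ σ u
  σ-range : All (InRange lo i) σ
  σ-range = All.zipWith (λ ((lo≤y , _) , y<x) → lo≤y , y<x) (++⁻ˡ σ inr , σ<x)
  top : lo + suc (length (σ ++ τ)) ≡ suc (lo + i) + j
  top = trans (+-suc lo _) (cong suc (trans (cong (lo +_) (sym i+j≡)) (sym (+-assoc lo i j))))
  τ-range : All (InRange (suc (lo + i)) j) τ
  τ-range = All.zipWith (λ {y} ((_ , y<) , x<y) → x<y , subst (y <_) top y<) (++⁻ʳ σ inr , x<τ)
  -- Pigeonhole bounds the blocks by `i` and `j`, and together they have `i + j` entries; so each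
  -- block fills its interval and the recursion applies.
  tight : length σ ≡ i × length τ ≡ j
  tight = both-tight (interval-length≤ uσ σ-range) (interval-length≤ uτ τ-range)
                     (trans (sym (length-++ σ)) (sym i+j≡))
  σ≤h : length σ ≤ h
  σ≤h = ≤-trans (m≤m+n _ _) (subst (_≤ h) (length-++ σ) len)
  τ≤h : length τ ≤ h
  τ≤h = ≤-trans (m≤n+m _ _) (subst (_≤ h) (length-++ σ) len)
  finish : ∃[ t ] word lo t ≡ lo + i ∷ σ ++ τ
  finish with refl , refl ← tight
    with l , refl ← tree-of h lo σ σ≤h (uσ , σ-range) (avoiding-++⁻ˡ σ av)
    with r , refl ← tree-of h (suc (lo + length σ)) τ τ≤h (uτ , τ-range) (avoiding-++⁻ʳ σ av)
    = node l r , cong (λ s → lo + s ∷ word lo l ++ word (suc (lo + s)) r) (sym (length-word lo l))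

-- Enumeration of trees

-- h bounds the height; it only makes the recursion structural.
trees  : ℕ → ℕ → List Tree
rooted : ℕ → ℕ → ℕ → List Tree

trees h       zero    = [ leaf ]
trees zero    (suc n) = []
trees (suc h) (suc n) =
  concat (applyUpTo (rooted h n) (suc n))

rooted h n i = cartesianProductWith node (trees h i) (trees h (n ∸ i))

trees-sound : ∀ h n {t} → t ∈ trees h n → size t ≡ n
trees-sound h       zero    (here refl) = refl
trees-sound (suc h) (suc n) t∈
  with _ , t∈ts , ts∈ ← ∈-concat⁻′ (applyUpTo (rooted h n) (suc n)) t∈
  with i , i<n , refl ← ∈-applyUpTo⁻ (rooted h n) ts∈
  with l , r , l∈ , r∈ , refl ← ∈-cartesianProductWith⁻ node (trees h i) (trees h (n ∸ i)) t∈ts =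
  cong suc (trans (cong₂ _+_ (trees-sound h i l∈) (trees-sound h (n ∸ i) r∈)) (m+[n∸m]≡n (s≤s⁻¹ i<n)))

trees-complete : ∀ h t → size t ≤ h → t ∈ trees h (size t)
trees-complete h       leaf       _         = here refl
trees-complete (suc h) (node l r) (s≤s t≤h) =
  ∈-concat⁺′
    (∈-cartesianProductWith⁺ node
      (trees-complete h l (≤-trans (m≤m+n _ _) t≤h))
      (subst (λ m → r ∈ trees h m) (sym (m+n∸m≡n (size l) (size r)))
        (trees-complete h r (≤-trans (m≤n+m _ _) t≤h))))
    (∈-applyUpTo⁺ (rooted h (size l + size r))
      (s≤s (m≤m+n (size l) (size r))))

trees-unique : ∀ h n → Unique (trees h n)
trees-unique h       zero    = [] ∷ []
trees-unique zero    (suc n) = []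
trees-unique (suc h) (suc n) = Unique.concat⁺
  (All-applyUpTo⁺₂ (rooted h n) (suc n) λ i →
    Unique.cartesianProductWith⁺ node (λ { refl → refl , refl }) (trees-unique h i) (trees-unique h (n ∸ i)))
  (AllPairsₚ.applyUpTo⁺₁ (rooted h n) (suc n) λ i<j _ → disjoint i<j)
  where
  -- The index of a block is the size of the left subtree of each of its trees.
  disjoint : ∀ {i j} → i < j → Disjoint (rooted h n i) (rooted h n j)
  disjoint {i} {j} i<j (t∈i , t∈j)
    with l , _ , l∈i , _ , refl ← ∈-cartesianProductWith⁻ node (trees h i) (trees h (n ∸ i)) t∈i
    with _ , _ , l∈j , _ , refl ← ∈-cartesianProductWith⁻ node (trees h j) (trees h (n ∸ j)) t∈j =
    <⇒≢ i<j (trans (sym (trees-sound h i l∈i)) (trees-sound h j l∈j))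

#trees : ℕ → ℕ
#trees n = length (trees n n)

-- Any height bound of at least `n` yields all trees of size `n`, each once, so the length does not
-- depend on the bound.
trees-stable : ∀ {h n} → n ≤ h → length (trees h n) ≡ #trees n
trees-stable {h} {n} n≤h = unique-≋⇒length≡ (trees-unique h n) (trees-unique n n)
  (λ {t} t∈ → via n ≤-refl (trees-sound h n t∈)) (λ {t} t∈ → via h n≤h (trees-sound n n t∈))
  where
  via : ∀ h → n ≤ h → ∀ {t} → size t ≡ n → t ∈ trees h n
  via h n≤h refl = trees-complete h _ n≤h

length-cartesianProductWith : ∀ {A B C : Set} (f : A → B → C) xs ys →
  length (cartesianProductWith f xs ys) ≡ length xs * length ys
length-cartesianProductWith f []       ys = refl
length-cartesianProductWith f (x ∷ xs) ys =
  trans (length-++ (map (f x) ys)) (cong₂ _+_ (length-map (f x) ys) (length-cartesianProductWith f xs ys))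

length-concat-applyUpTo : ∀ {A : Set} (f : ℕ → List A) n →
  length (concat (applyUpTo f n)) ≡ sum (applyUpTo (length ∘ f) n)
length-concat-applyUpTo f zero    = refl
length-concat-applyUpTo f (suc n) = trans (length-++ (f 0)) (cong (length (f 0) +_) (length-concat-applyUpTo (f ∘ suc) n))

sum-applyUpTo-cong : ∀ {f g : ℕ → ℕ} n → (∀ i → i < n → f i ≡ g i) → sum (applyUpTo f n) ≡ sum (applyUpTo g n)
sum-applyUpTo-cong zero    eq = refl
sum-applyUpTo-cong (suc n) eq = cong₂ _+_ (eq 0 z<s) (sum-applyUpTo-cong n (λ i i<n → eq (suc i) (s<s i<n)))

-- The blocks are indexed by the size of the left subtree. Both subtrees are enumerated with bound
-- `n`, which `trees-stable` replaces by their sizes.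
#trees-suc : ∀ n → #trees (suc n) ≡ (#trees ⊛ #trees) n
#trees-suc n = trans (length-concat-applyUpTo (rooted n n) (suc n)) (sum-applyUpTo-cong (suc n) λ i i<n →
  trans (length-cartesianProductWith node (trees n i) (trees n (n ∸ i)))
        (cong₂ _*_ (trees-stable (s≤s⁻¹ i<n)) (trees-stable (m∸n≤m n i))))

#trees≗catalan : #trees ≗ catalan
#trees≗catalan = segner⇒catalan #trees refl #trees-suc

-- The recurrence of the closed form is read off from the trees that it counts.
catalan-suc : ∀ n → catalan (suc n) ≡ (catalan ⊛ catalan) n
catalan-suc n = trans (sym (#trees≗catalan (suc n))) (trans (#trees-suc n)
  (sum-applyUpTo-cong (suc n) λ i _ → cong₂ _*_ (#trees≗catalan i) (#trees≗catalan (n ∸ i))))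

-- Avoiding lists with the prescribed beginning

-- The list form of beginning with the pattern for `k = m + 1`; the entry `z` plays the final `k`.
FallsThenTops : ℕ → List ℕ → Set
FallsThenTops m xs = ∃[ d ] ∃[ z ] ∃[ rest ]
  xs ≡ d ++ z ∷ rest × length d ≡ m × AllPairs _>_ d × All (_< z) d

-- The head is at most the length of the tail by hypothesis, and at least that length because the
-- tail consists of distinct smaller numbers.
falling⇒downFrom : ∀ d → AllPairs _>_ d → All (_< length d) d → d ≡ downFrom (length d)
falling⇒downFrom []       _            _          = refl
falling⇒downFrom (x ∷ xs) (x>xs ∷ >xs) (x< ∷ _) =
  cong₂ _∷_ (≤-antisym (s≤s⁻¹ x<) xs≤x)
            (falling⇒downFrom xs >xs (All.map (λ y<x → <-≤-trans y<x (s≤s⁻¹ x<)) x>xs))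
  where
  xs≤x : length xs ≤ x
  xs≤x = interval-length≤ {lo = 0} (AllPairs.map >⇒≢ >xs) (All.map (z≤n ,_) x>xs)

-- Each entry of `d` can play the 2, and `z` lies above it, so `stays-above` applies from `z` on.
falls-below-rest : ∀ d {z rest} → Unique (d ++ z ∷ rest) → Avoiding (d ++ z ∷ rest) → All (_< z) d →
  All (λ x → All (x <_) (z ∷ rest)) d
falls-below-rest []      _        _         _          = []
falls-below-rest (x ∷ d) (x≢ ∷ u) (nd ∷ av) (x<z ∷ d<z) =
  stays-above (noDrop-++⁻ʳ d nd) (++⁻ʳ d x≢) x<z ∷ falls-below-rest d u av d<z

-- The falling part must consist of the `m` smallest values, which determines it. What follows is an
-- avoiding permutation of the interval from `m`, hence the word of a tree.
standard-form : ∀ {m xs} → PermFrom 0 xs → Avoiding xs → FallsThenTops m xs →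
  ∃[ t ] xs ≡ downFrom m ++ word m t
standard-form (u , inr) av (d , z , rest , refl , refl , >d , d<z)
  = let t , eq = tree-of _ (length d) s ≤-refl (us , s-range) (avoiding-++⁻ʳ d av)
    in t , cong₂ _++_ d≡ (sym eq)
  where
  s = z ∷ rest
  us : Unique s
  us = AllPairs-++⁻ʳ d u
  below : All (λ x → All (x <_) s) d
  below = falls-below-rest d u av d<z
  inr′ : All (λ x → x < length d + length s) (d ++ s)
  inr′ = All.map (λ {x} (_ , x<) → subst (x <_) (length-++ d) x<) inr
  d-small : All (_< length d) d
  d-small = All.zipWith small (++⁻ˡ d inr′ , below)
    where
    -- The letters after d lie strictly above x, so there are too many of them unless x < length d.
    small : ∀ {x} → x < length d + length s × All (x <_) s → x < length d
    small {x} (x< , x<s) with o , eq ← m≤n⇒∃[o]m+o≡n x< =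
      +-cancelʳ-≤ (length s) (suc x) (length d)
        (subst (suc x + length s ≤_) eq (+-monoʳ-≤ (suc x) (interval-length≤ us s-range)))
      where
      s-range : All (InRange (suc x) o) s
      s-range = All.zipWith (λ {y} (x<y , y<) → x<y , subst (y <_) (sym eq) y<) (x<s , ++⁻ʳ d inr′)
  d≡ : d ≡ downFrom (length d)
  d≡ = falling⇒downFrom d >d d-small
  -- For nonempty `d` the head is the largest letter, one less than the length, and `s` lies
  -- strictly above it.
  above : ∀ m → d ≡ downFrom m → All (m ≤_) s
  above zero    _  = All.universal (λ _ → z≤n) s
  above (suc m) eq = All.head (subst (All _) eq below)
  s-range : All (InRange (length d) (length s)) s
  s-range = All.zip (above (length d) d≡ , ++⁻ʳ d inr′)

downFrom-falls : ∀ m → AllPairs _>_ (downFrom m)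
downFrom-falls m = AllPairsₚ.applyDownFrom⁺₁ id m (λ j<i _ → j<i)

downFrom-< : ∀ m → All (_< m) (downFrom m)
downFrom-< m = All-applyDownFrom⁺₁ id m id

falling⇒avoiding : ∀ {xs} → AllPairs _>_ xs → Avoiding xs
falling⇒avoiding []         = []
falling⇒avoiding (x> ∷ xs>) = noDrop-below x> ∷ falling⇒avoiding xs>

module _ (m : ℕ) (t : Tree) where

  private
    below : All (λ x → All (x <_) (word m t)) (downFrom m)
    below = All.map (λ x<m → All.map (<-≤-trans x<m) (word-≥ m t)) (downFrom-< m)

  length-standard : length (downFrom m ++ word m t) ≡ m + size t
  length-standard = trans (length-++ (downFrom m)) (cong₂ _+_ (length-downFrom m) (length-word m t))

  standard-perm : PermFrom 0 (downFrom m ++ word m t)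
  standard-perm =
    Unique-++-< (AllPairs.map >⇒≢ (downFrom-falls m)) (word-unique m t) below ,
    subst (λ n → All (InRange 0 n) (downFrom m ++ word m t)) (sym length-standard)
      (++⁺ (All.map (λ x<m → z≤n , <-≤-trans x<m (m≤m+n m _)) (downFrom-< m))
           (All.map (λ (_ , x<) → z≤n , x<) (word-range m t)))

  standard-avoiding : Avoiding (downFrom m ++ word m t)
  standard-avoiding = avoiding-++ (falling⇒avoiding (downFrom-falls m)) (word-avoiding m t) below

standard-falls : ∀ m t → 0 < size t → FallsThenTops m (downFrom m ++ word m t)
standard-falls m (node l r) _ =
  -- The entry above the falling part is the root label; a leaf would provide none.
  downFrom m , m + size l , _ , refl , length-downFrom m , downFrom-falls m ,
  All.map (λ x<m → <-≤-trans x<m (m≤m+n m _)) (downFrom-< m)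

-- Words as lists of numbers

letters : ∀ {m n} → Word m n → List ℕ
letters w = List.map toℕ (toList w)

length-letters : ∀ {m n} (w : Word m n) → length (letters w) ≡ n
length-letters []      = refl
length-letters (_ ∷ w) = cong suc (length-letters w)

letters-injective : ∀ {m n} {v w : Word m n} → letters v ≡ letters w → v ≡ w
letters-injective {v = []}    {[]}    _  = refl
letters-injective {v = _ ∷ _} {_ ∷ _} eq =
  cong₂ _∷_ (toℕ-injective (∷-injectiveˡ eq)) (letters-injective (∷-injectiveʳ eq))

letters-∷ʳ : ∀ {m n} (w : Word m n) x → letters (w ∷ʳ x) ≡ letters w ++ toℕ x ∷ []
letters-∷ʳ []      x = refl
letters-∷ʳ (y ∷ w) x = cong (toℕ y ∷_) (letters-∷ʳ w x)

letters-surjective : ∀ {m n xs} → All (_< m) xs → length xs ≡ n → ∃[ w ] letters {m} {n} w ≡ xs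
letters-surjective []         refl = [] , refl
letters-surjective (x<m ∷ xs<m) refl with w , eq ← letters-surjective xs<m refl =
  fromℕ< x<m ∷ w , cong₂ _∷_ (toℕ-fromℕ< x<m) eq

letters-<  : ∀ {m n} (w : Word m n) → All (_< m) (letters w)
letters-< []      = []
letters-< (x ∷ w) = toℕ<n x ∷ letters-< w

module _ {P : ℕ → Set} where

  all⁺ : ∀ {m n} (w : Word m n) → (∀ i → P (toℕ (lookup w i))) → All P (letters w)
  all⁺ []      p = []
  all⁺ (_ ∷ w) p = p zero ∷ all⁺ w (p ∘ suc)

  all⁻ : ∀ {m n} (w : Word m n) → All P (letters w) → ∀ i → P (toℕ (lookup w i))
  all⁻ (_ ∷ w) (p ∷ _)  zero    = p
  all⁻ (_ ∷ w) (_ ∷ ps) (suc i) = all⁻ w ps i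

module _ {R : ℕ → ℕ → Set} where

  allPairs⁺ : ∀ {m n} (w : Word m n) →
    (∀ i j → i Fin.< j → R (toℕ (lookup w i)) (toℕ (lookup w j))) → AllPairs R (letters w)
  allPairs⁺ []      r = []
  allPairs⁺ (_ ∷ w) r = all⁺ w (λ j → r zero (suc j) z<s) ∷ allPairs⁺ w (λ i j i<j → r (suc i) (suc j) (s<s i<j))

  allPairs⁻ : ∀ {m n} (w : Word m n) → AllPairs R (letters w) →
    ∀ i j → i Fin.< j → R (toℕ (lookup w i)) (toℕ (lookup w j))
  allPairs⁻ (_ ∷ w) (r ∷ _)  zero    (suc j) _   = all⁻ w r j
  allPairs⁻ (_ ∷ w) (_ ∷ rs) (suc i) (suc j) i<j = allPairs⁻ w rs i j (s<s⁻¹ i<j)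

  linked⁺ : ∀ {m n} (w : Word m n) →
    (∀ j j⁺ → toℕ j⁺ ≡ suc (toℕ j) → R (toℕ (lookup w j)) (toℕ (lookup w j⁺))) → Linked R (letters w)
  linked⁺ []          r = []
  linked⁺ (_ ∷ [])    r = [-]
  linked⁺ (_ ∷ y ∷ w) r = r zero (suc zero) refl ∷ linked⁺ (y ∷ w) (λ j j⁺ eq → r (suc j) (suc j⁺) (cong suc eq))

  linked⁻ : ∀ {m n} (w : Word m n) → Linked R (letters w) →
    ∀ j j⁺ → toℕ j⁺ ≡ suc (toℕ j) → R (toℕ (lookup w j)) (toℕ (lookup w j⁺))
  linked⁻ (_ ∷ _ ∷ w) (r ∷ _)  zero    (suc zero) _  = r
  linked⁻ (_ ∷ y ∷ w) (_ ∷ rs) (suc j) (suc j⁺)   eq = linked⁻ (y ∷ w) rs j j⁺ (suc-injective eq)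

-- Permutations and 2-31 avoidance in terms of lists

unique⁺ : ∀ {n} (π : Word n n) → IsPermutation π → Unique (letters π)
unique⁺ π u = Unique.map⁺ toℕ-injective (toList-unique u)
  where
  toList-all : ∀ {m n} {P : Fin m → Set} {w : Word m n} → VecAll.All P w → All P (toList w)
  toList-all VecAll.[]       = []
  toList-all (p VecAll.∷ ps) = p ∷ toList-all ps
  toList-unique : ∀ {m n} {w : Word m n} → VecAllPairs.AllPairs _≢_ w → Unique (toList w)
  toList-unique VecAllPairs.[]       = []
  toList-unique (p VecAllPairs.∷ ps) = toList-all p ∷ toList-unique ps

unique⁻ : ∀ {m n} (w : Word m n) → Unique (letters w) → VecAllPairs.AllPairs _≢_ w
unique⁻ []      _        = VecAllPairs.[]
unique⁻ (x ∷ w) (x≢ ∷ u) = fresh w x≢ VecAllPairs.∷ unique⁻ w u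
  where
  fresh : ∀ {n} (w : Word _ n) → All (toℕ x ≢_) (letters w) → VecAll.All (x ≢_) w
  fresh []      []       = VecAll.[]
  fresh (y ∷ w) (p ∷ ps) = (p ∘ cong toℕ) VecAll.∷ fresh w ps

permFrom : ∀ {n} (π : Word n n) → IsPermutation π → PermFrom 0 (letters π)
permFrom π u = unique⁺ π u , subst (λ m → All (InRange 0 m) (letters π)) (sym (length-letters π))
                               (All.map (z≤n ,_) (letters-< π))

module _ {m} {x y z : Fin m} where

  iso-231⁻ : OrderIso (x ∷ y ∷ z ∷ []) p231 → z Fin.< x × x Fin.< y
  iso-231⁻ iso = iso (suc (suc zero)) zero .from z<s , iso zero (suc zero) .from (s<s z<s)

  iso-231⁺ : z Fin.< x → x Fin.< y → OrderIso (x ∷ y ∷ z ∷ []) p231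
  iso-231⁺ z<x x<y = iso
    where
    z<y : z Fin.< y
    z<y = <-trans z<x x<y
    absurd : ∀ {A B : Set} → ¬ A → ¬ B → A ⇔ B
    absurd ¬a ¬b = mk⇔ (λ a → contradiction a ¬a) (λ b → contradiction b ¬b)
    both : ∀ {A B : Set} → A → B → A ⇔ B
    both a b = mk⇔ (λ _ → b) (λ _ → a)
    iso : OrderIso (x ∷ y ∷ z ∷ []) p231
    iso zero             zero             = absurd (n≮n _) (n≮n _)
    iso zero             (suc zero)       = both x<y (s<s z<s)
    iso zero             (suc (suc zero)) = absurd (<-asym z<x) (λ ())
    iso (suc zero)       zero             = absurd (<-asym x<y) (λ { (s≤s ()) })
    iso (suc zero)       (suc zero)       = absurd (n≮n _) (n≮n _)
    iso (suc zero)       (suc (suc zero)) = absurd (<-asym z<y) (λ ())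
    iso (suc (suc zero)) zero             = both z<x z<s
    iso (suc (suc zero)) (suc zero)       = both z<y z<s
    iso (suc (suc zero)) (suc (suc zero)) = absurd (n≮n _) (n≮n _)

-- `Avoids2-31` with the order isomorphism replaced by the two comparisons that determine it.
-- Alphabet size and length are independent, so that tails of words are covered.
NoDescentAcross : ∀ {m n} → Word m n → Set
NoDescentAcross {n = n} w = ∀ (i j j⁺ : Fin n) → i Fin.< j → toℕ j⁺ ≡ suc (toℕ j) →
  ¬ (lookup w j⁺ Fin.< lookup w i × lookup w i Fin.< lookup w j)

avoiding⁺ : ∀ {m n} (w : Word m n) → NoDescentAcross w → Avoiding (letters w)
avoiding⁺ []      _ = []
avoiding⁺ (x ∷ w) a =
  linked⁺ w (λ j j⁺ eq → a zero (suc j) (suc j⁺) z<s (cong suc eq)) ∷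
  avoiding⁺ w (λ i j j⁺ i<j eq → a (suc i) (suc j) (suc j⁺) (s<s i<j) (cong suc eq))

avoiding⁻ : ∀ {m n} (w : Word m n) → Avoiding (letters w) → NoDescentAcross w
avoiding⁻ (x ∷ w) (nd ∷ _) zero    (suc j) (suc j⁺) _   eq = linked⁻ w nd j j⁺ (suc-injective eq)
avoiding⁻ (x ∷ w) (_ ∷ av) (suc i) (suc j) (suc j⁺) i<j eq = avoiding⁻ w av i j j⁺ (s<s⁻¹ i<j) (suc-injective eq)

avoids⇒avoiding : ∀ {n} (π : Word n n) → Avoids2-31 π → Avoiding (letters π)
avoids⇒avoiding π av = avoiding⁺ π λ i j j⁺ i<j eq (z<x , x<y) →
  av (i , j , j⁺ , i<j , eq , iso-231⁺ z<x x<y)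

avoiding⇒avoids : ∀ {n} (π : Word n n) → Avoiding (letters π) → Avoids2-31 π
avoiding⇒avoids π av (i , j , j⁺ , i<j , eq , iso) = avoiding⁻ π av i j j⁺ i<j eq (iso-231⁻ iso)

-- The initial pattern

lookup-∷ʳ-inject₁ : ∀ {A : Set} {n} (v : Vec A n) x i → lookup (v ∷ʳ x) (inject₁ i) ≡ lookup v i
lookup-∷ʳ-inject₁ (_ ∷ _) x zero    = refl
lookup-∷ʳ-inject₁ (_ ∷ v) x (suc i) = lookup-∷ʳ-inject₁ v x i

lookup-∷ʳ-fromℕ : ∀ {A : Set} {n} (v : Vec A n) x → lookup (v ∷ʳ x) (fromℕ n) ≡ x
lookup-∷ʳ-fromℕ []      x = refl
lookup-∷ʳ-fromℕ (_ ∷ v) x = lookup-∷ʳ-fromℕ v x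

FallsTo : ∀ {a m} → Word a m → Fin a → Set
FallsTo d z = AllPairs _>_ (letters d) × All (_< toℕ z) (letters d)

-- In such words the positions alone decide every comparison: the last letter is largest, and among
-- the others a later letter is smaller. Hence all of them have the same order type.
fallsTo-mono : ∀ {a b m} {d : Word a m} {z} {d′ : Word b m} {z′} → FallsTo d z → FallsTo d′ z′ →
  ∀ i j → lookup (d ∷ʳ z) i Fin.< lookup (d ∷ʳ z) j → lookup (d′ ∷ʳ z′) i Fin.< lookup (d′ ∷ʳ z′) j
fallsTo-mono {d = d} {z} {d′} {z′} (d> , d<z) (d′> , d′<z′) i j i<j with view i | view j
... | ‵fromℕ | ‵fromℕ = contradiction i<j (n≮n _)
... | ‵fromℕ | ‵inject₁ j
  rewrite lookup-∷ʳ-fromℕ d z | lookup-∷ʳ-inject₁ d z j = contradiction i<j (<-asym (all⁻ d d<z j))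
... | ‵inject₁ i | ‵fromℕ
  rewrite lookup-∷ʳ-fromℕ d′ z′ | lookup-∷ʳ-inject₁ d′ z′ i = all⁻ d′ d′<z′ i
... | ‵inject₁ i | ‵inject₁ j
  rewrite lookup-∷ʳ-inject₁ d z i | lookup-∷ʳ-inject₁ d z j | lookup-∷ʳ-inject₁ d′ z′ i | lookup-∷ʳ-inject₁ d′ z′ j
  with <-cmp (toℕ i) (toℕ j)
...   | tri< p _ _ = contradiction i<j (<-asym (allPairs⁻ d d> i j p))
...   | tri≈ _ p _ with refl ← toℕ-injective p = contradiction i<j (n≮n _)
...   | tri> _ _ p = allPairs⁻ d′ d′> j i p

fallsTo⇒iso : ∀ {a b m} {d : Word a m} {z} {d′ : Word b m} {z′} →
  FallsTo d z → FallsTo d′ z′ → OrderIso (d ∷ʳ z) (d′ ∷ʳ z′)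
fallsTo⇒iso f f′ i j = mk⇔ (fallsTo-mono f f′ i j) (fallsTo-mono f′ f i j)

iso⇒fallsTo : ∀ {a b m} {d : Word a m} {z} {d′ : Word b m} {z′} →
  OrderIso (d ∷ʳ z) (d′ ∷ʳ z′) → FallsTo d′ z′ → FallsTo d z
iso⇒fallsTo {d = d} {z} {d′} {z′} iso (d′> , d′<z′) =
  allPairs⁺ d (λ i j i<j →
    subst₂ Fin._<_ (lookup-∷ʳ-inject₁ d z j) (lookup-∷ʳ-inject₁ d z i) (iso (inject₁ j) (inject₁ i) .from
      (subst₂ Fin._<_ (sym (lookup-∷ʳ-inject₁ d′ z′ j)) (sym (lookup-∷ʳ-inject₁ d′ z′ i)) (allPairs⁻ d′ d′> i j i<j)))) ,
  all⁺ d (λ i →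
    subst₂ Fin._<_ (lookup-∷ʳ-inject₁ d z i) (lookup-∷ʳ-fromℕ d z) (iso (inject₁ i) (fromℕ _) .from
      (subst₂ Fin._<_ (sym (lookup-∷ʳ-inject₁ d′ z′ i)) (sym (lookup-∷ʳ-fromℕ d′ z′)) (all⁻ d′ d′<z′ i))))

letters-inject₁ : ∀ {m n} (w : Word m n) → letters (Vec.map inject₁ w) ≡ letters w
letters-inject₁ []      = refl
letters-inject₁ (x ∷ w) = cong₂ _∷_ (toℕ-inject₁ x) (letters-inject₁ w)

letters-reverse-allFin : ∀ m → letters (Vec.reverse (allFin m)) ≡ downFrom m
letters-reverse-allFin m = begin
  List.map toℕ (toList (Vec.reverse (allFin m)))   ≡⟨ cong (List.map toℕ) (toList-reverse (allFin m)) ⟩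
  List.map toℕ (List.reverse (toList (allFin m)))  ≡⟨ reverse-map toℕ (toList (allFin m)) ⟩
  List.reverse (letters (allFin m))                ≡⟨ cong List.reverse (letters-tabulate {m} id id (λ _ → refl)) ⟩
  List.reverse (upTo m)                            ≡⟨ reverse-upTo m ⟩
  downFrom m                                       ∎
  where
  letters-tabulate : ∀ {m n} (f : Fin n → Fin m) (g : ℕ → ℕ) → (∀ i → toℕ (f i) ≡ g (toℕ i)) →
    letters (Vec.tabulate f) ≡ List.applyUpTo g n
  letters-tabulate {n = zero}  f g eq = refl
  letters-tabulate {n = suc n} f g eq = cong₂ _∷_ (eq zero) (letters-tabulate (f ∘ suc) (g ∘ suc) (eq ∘ suc))

initialPattern-fallsTo : ∀ m → FallsTo (Vec.map inject₁ (Vec.reverse (allFin m))) (fromℕ m)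
initialPattern-fallsTo m =
  subst (AllPairs _>_) (sym eq) (downFrom-falls m) ,
  subst₂ (λ k → All (_< k)) (sym (toℕ-fromℕ m)) (sym eq) (downFrom-< m)
  where
  eq : letters (Vec.map inject₁ (Vec.reverse (allFin m))) ≡ downFrom m
  eq = trans (letters-inject₁ _) (letters-reverse-allFin m)

letters-truncate : ∀ {a k n} (k≤n : k ≤ n) (w : Word a n) → ∃[ rest ] letters w ≡ letters (truncate k≤n w) ++ rest
letters-truncate z≤n       w       = letters w , refl
letters-truncate (s≤s k≤n) (x ∷ w) with rest , eq ← letters-truncate k≤n w = rest , cong (toℕ x ∷_) eq

split-prefix : ∀ {a m n} (k≤n : suc m ≤ n) (w : Word a n) →
  ∃[ d ] ∃[ z ] ∃[ rest ] truncate k≤n w ≡ d ∷ʳ z × letters w ≡ letters d ++ toℕ z ∷ rest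
split-prefix k≤n w with d , z , eq ← initLast (truncate k≤n w) | rest , eq′ ← letters-truncate k≤n w =
  d , z , rest , eq ,
  trans eq′ (trans (cong (_++ rest) (trans (cong letters eq) (letters-∷ʳ d z))) (++-assoc (letters d) _ rest))

hasPrefix⇒falls : ∀ {m n} (π : Word n n) → HasPrefix (initialPattern (suc m)) π → FallsThenTops m (letters π)
hasPrefix⇒falls {m} π (k≤n , iso) with d , z , rest , eq , eq′ ← split-prefix k≤n π
  with d> , d<z ← iso⇒fallsTo {d = d} (subst (λ w → OrderIso w (initialPattern (suc m))) eq iso) (initialPattern-fallsTo m) =
  letters d , toℕ z , rest , eq′ , length-letters d , d> , d<z

falls⇒hasPrefix : ∀ {m n} (π : Word n n) → suc m ≤ n → FallsThenTops m (letters π) → HasPrefix (initialPattern (suc m)) π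
falls⇒hasPrefix {m} π k≤n (d , z , rest , eq , |d|≡m , d> , d<z)
  with d′ , z′ , rest′ , eq′ , eq″ ← split-prefix k≤n π
  -- Both decompositions cut after `m` letters, so they have the same falling part and the same next
  -- letter.
  with d≡ , s≡ ← ++-injective (letters d′) {cs = d} (trans (length-letters d′) (sym |d|≡m)) (trans (sym eq″) eq)
  with refl ← d≡ | refl ← ∷-injectiveˡ s≡ =
  k≤n , subst (λ w → OrderIso w (initialPattern (suc m))) (sym eq′) (fallsTo⇒iso {d = d′} (d> , d<z) (initialPattern-fallsTo m))

-- Counting words by trees

words-unique : ∀ m n → Unique (words m n)
words-unique m zero    = [] ∷ []
words-unique m (suc n) = Unique.cartesianProductWith⁺ _∷_ ∷-injective (Unique.allFin⁺ m) (words-unique m n)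

words-complete : ∀ {m n} (w : Word m n) → w ∈ words m n
words-complete []      = here refl
words-complete (x ∷ w) = ∈-cartesianProductWith⁺ _∷_ (∈-allFin x) (words-complete w)

-- Words and elements of `as` are compared through their images among lists of numbers: both maps
-- are injective, and the images are duplicate-free with the same members.
count-via : ∀ {m n} {A : Set} {P : Word m n → Set} (P? : Decidable P) (f : A → List ℕ) {as : List A} →
  (∀ {a b} → f a ≡ f b → a ≡ b) → Unique as →
  (∀ w → P w → ∃[ a ] a ∈ as × letters w ≡ f a) →
  (∀ {a} → a ∈ as → ∃[ w ] P w × letters w ≡ f a) →
  length (filter P? (words m n)) ≡ length as
count-via {m} {n} P? f {as} f-injective as-unique forth back = begin
  length counted                     ≡⟨ length-map letters counted ⟨
  length (List.map letters counted)  ≡⟨ unique-≋⇒length≡ (Unique.map⁺ letters-injective (Unique.filter⁺ P? (words-unique m n)))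
                                                         (Unique.map⁺ f-injective as-unique) ⊆ʳ ⊆ˡ ⟩
  length (List.map f as)             ≡⟨ length-map f as ⟩
  length as                          ∎
  where
  counted = filter P? (words m n)
  ⊆ʳ : List.map letters counted ⊆ List.map f as
  ⊆ʳ xs∈ with w , w∈ , refl ← ∈-map⁻ letters xs∈
    with a , a∈ , eq ← forth w (proj₂ (∈-filter⁻ P? {xs = words m n} w∈)) =
    subst (_∈ List.map f as) (sym eq) (∈-map⁺ f a∈)
  ⊆ˡ : List.map f as ⊆ List.map letters counted
  ⊆ˡ xs∈ with a , a∈ , refl ← ∈-map⁻ f xs∈ with w , pw , eq ← back a∈ =
    subst (_∈ List.map letters counted) eq (∈-map⁺ letters (∈-filter⁺ P? (words-complete w) pw))

module _ (m j : ℕ) where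

  private
    -- This covers `n ≥ k` for `k = m + 1`: after `m` falling letters, a nonempty tree of size
    -- `suc j` remains.
    n = m + suc j

    Counted : Word n n → Set
    Counted π = IsPermutation π × Avoids2-31 π × HasPrefix (initialPattern (suc m)) π

  counted⇒standard : ∀ π → Counted π → ∃[ t ] t ∈ trees (suc j) (suc j) × letters π ≡ downFrom m ++ word m t
  counted⇒standard π (perm , av , pre)
    with t , eq ← standard-form (permFrom π perm) (avoids⇒avoiding π av) (hasPrefix⇒falls π pre) =
    t , subst (λ k → t ∈ trees k k) |t| (trees-complete (size t) t ≤-refl) , eq
    where
    |t| : size t ≡ suc j
    |t| = +-cancelˡ-≡ m _ _ (trans (sym (length-standard m t)) (trans (cong length (sym eq)) (length-letters π)))

  standard⇒counted : ∀ {t} → t ∈ trees (suc j) (suc j) → ∃[ π ] Counted π × letters π ≡ downFrom m ++ word m t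
  standard⇒counted {t} t∈ = π , counted , eq
    where
    |t| : size t ≡ suc j
    |t| = trees-sound (suc j) (suc j) t∈
    len : length (downFrom m ++ word m t) ≡ n
    len = trans (length-standard m t) (cong (m +_) |t|)
    realised : ∃[ w ] letters {n} {n} w ≡ downFrom m ++ word m t
    realised = letters-surjective
      (subst (λ k → All (_< k) (downFrom m ++ word m t)) len (All.map proj₂ (proj₂ (standard-perm m t)))) len
    π = proj₁ realised
    eq = proj₂ realised
    counted : Counted π
    counted =
      unique⁻ π (subst Unique (sym eq) (proj₁ (standard-perm m t))) ,
      avoiding⇒avoids π (subst Avoiding (sym eq) (standard-avoiding m t)) ,
      falls⇒hasPrefix π (subst (suc m ≤_) (sym (+-suc m j)) (s≤s (m≤m+n m j)))
        (subst (FallsThenTops m) (sym eq) (standard-falls m t (subst (0 <_) (sym |t|) z<s)))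

  N₀-counts-trees : N₀ (initialPattern (suc m)) n ≡ #trees (suc j)
  N₀-counts-trees = count-via
    (λ π → isPermutation? π ×-dec avoids2-31? π ×-dec hasPrefix? (initialPattern (suc m)) π)
    (λ t → downFrom m ++ word m t)
    (λ eq → word-injective m (proj₂ (++-injective (downFrom m) refl eq)))
    (trees-unique (suc j) (suc j)) counted⇒standard standard⇒counted

-- Coefficients and generating functions

N₀-short : ∀ {k n} (p : Word k k) → n < k → N₀ p n ≡ 0
N₀-short {n = n} p n<k = cong length (filter-none
  (λ π → isPermutation? π ×-dec avoids2-31? π ×-dec hasPrefix? p π)
  (All.universal (λ π (_ , _ , k≤n , _) → <⇒≱ n<k k≤n) (words n n)))

if-≤ᵇ : ∀ {A : Set} {x a b : A} k n → (k ≤ n → x ≡ a) → (n < k → x ≡ b) → x ≡ (if k ≤ᵇ n then a else b)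
if-≤ᵇ k n then-case else-case with k ≤ᵇ n in eq
... | true  = then-case (≤ᵇ⇒≤ k n (subst T (sym eq) tt))
... | false = else-case (≰⇒> λ k≤n → subst T eq (≤⇒≤ᵇ k≤n))

N₀-long : ∀ {m n} → suc m ≤ n → N₀ (initialPattern (suc m)) n ≡ catalan (n ∸ m)
N₀-long {m} m<n = at (m≤n⇒∃[o]m+o≡n m<n)
  where
  at : ∀ {n} → ∃[ j ] suc m + j ≡ n → N₀ (initialPattern (suc m)) n ≡ catalan (n ∸ m)
  at (j , refl) = subst (λ n → N₀ (initialPattern (suc m)) n ≡ catalan (n ∸ m)) (+-suc m j)
    (trans (N₀-counts-trees m j) (trans (#trees≗catalan (suc j)) (cong catalan (sym (m+n∸m≡n m (suc j))))))

N₀-initialPattern : ∀ m n → N₀ (initialPattern (suc m)) n ≡ (if suc m ≤ᵇ n then catalan (n ∸ m) else 0)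
N₀-initialPattern m n = if-≤ᵇ (suc m) n N₀-long (N₀-short (initialPattern (suc m)))

-- Outside the excluded case the second alternative of `BeginsWith` is void, so both filters select
-- the same words.
N≡N₀ : ∀ {k} (p : Word k k) n → ¬ (n ≡ 0 × k ≡ 1) → N p n ≡ N₀ p n
N≡N₀ p n ¬empty = cong length (filter-≐
  (λ π → isPermutation? π ×-dec avoids2-31? π ×-dec beginsWith? p π)
  (λ π → isPermutation? π ×-dec avoids2-31? π ×-dec hasPrefix? p π)
  ( (λ { (u , av , inj₁ pre) → u , av , pre ; (_ , _ , inj₂ e) → contradiction e ¬empty })
  , (λ (u , av , pre) → u , av , inj₁ pre))
  (words n n))

-- Segner's recurrence in the form `C = 1 + x C²`.
C² : ∀ n → (C ^ˢ 2) n ≡ catalan (suc n)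
C² n = trans (⊛-congʳ C (λ i → trans (⊛-comm C one i) (⊛-identityˡ C i)) n) (sym (catalan-suc n))

X^C² : ∀ m n → (X ^ˢ suc m ⊛ C ^ˢ 2) n ≡ (if suc m ≤ᵇ n then catalan (n ∸ m) else 0)
X^C² m n = if-≤ᵇ (suc m) n
  -- The shift by `m + 1` from the power of `X` and the index raised by one in `C²` combine to
  -- `n ∸ m`, as `m < n`.
  (λ m<n → trans (X^⊛-long (suc m) (C ^ˢ 2) m<n) (trans (C² (n ∸ suc m)) (cong catalan (sym (+-∸-assoc 1 m<n)))))
  (X^⊛-short (suc m) (C ^ˢ 2))

-- By convention the empty permutation counts for `k = 1`, while `x C²` has constant term 0. So the
-- formulas hold throughout for `G₀` and `N₀`, and for `G` and `N` away from `k = 1`, `n = 0`; the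
-- summand `one` corrects `G` for `k = 1`.
proposition25 : (k : ℕ) → 1 ≤ k →
    (G₀ (initialPattern k) ≗ X ^ˢ k ⊛ C ^ˢ 2)
    × ((n : ℕ) → N₀ (initialPattern k) n ≡ (if k ≤ᵇ n then catalan (n ∸ (k ∸ 1)) else 0))
    × (2 ≤ k → G (initialPattern k) ≗ X ^ˢ k ⊛ C ^ˢ 2)
    × (k ≡ 1 → G (initialPattern k) ≗ one ⊕ X ^ˢ k ⊛ C ^ˢ 2)
    × ((n : ℕ) → (k ≡ 1 → 1 ≤ n) → N (initialPattern k) n ≡ (if k ≤ᵇ n then catalan (n ∸ (k ∸ 1)) else 0))
proposition25 (suc m) _ =
    G₀-series
  , N₀-initialPattern m
  , (λ 2≤k n → trans (N≡N₀ p n (λ { (_ , refl) → n≮n 1 2≤k })) (G₀-series n))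
  , (λ { refl zero → refl ; refl (suc n) → trans (N≡N₀ p (suc n) (λ ())) (G₀-series (suc n)) })
  , (λ n k≡1⇒1≤n → trans (N≡N₀ p n (λ { (refl , k≡1) → n≮n 0 (k≡1⇒1≤n k≡1) })) (N₀-initialPattern m n))
  where
  p = initialPattern (suc m)
  G₀-series : G₀ p ≗ X ^ˢ suc m ⊛ C ^ˢ 2
  G₀-series n = trans (N₀-initialPattern m n) (sym (X^C² m n))
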